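{- Let $n\geq 4$, let $D_n$ be the $n$-dimensional dual cube and let $S=\{x,y,z,w\}$ be a set of four distinct vertices of $D_n$. If the vertices of $S$ lie in four different clusters of $D_n$, then there are $n-1$ internally disjoint trees connecting $S$ in $D_n$.
   Context: The $n$-dimensional dual cube $D_n$ has vertex set all binary strings $u_1u_2\cdots u_{2n-1}$ of length $2n-1$; two vertices $u,v$ are adjacent iff they differ in exactly one bit position $i$, and either $1\leq i\leq n-1$ and $u_{2n-1}=v_{2n-1}=0$, or $n\leq i\leq 2n-2$ and $u_{2n-1}=v_{2n-1}=1$, or $i=2n-1$. A cluster of class $0$ is the set of vertices with last bit $0$ and fixed bits in positions $n,\dots,2n-2$; a cluster of class $1$ is the set of vertices with last bit $1$ and fixed bits in positions $1,\dots,n-1$; each induces a copy of $Q_{n-1}$, and the clusters partition $V(D_n)$. Trees $T_1,\dots,T_m$ in a graph $G$ are internally disjoint trees connecting $S$ if each $T_i$ is a tree containing $S$, the trees are pairwise edge-disjoint, and $V(T_i)\cap V(T_j)=S$ for all $i\neq j$. -}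

module Defs where

open import Data.Nat using (ℕ; _+_; _∸_; _<_; _≤_)
open import Data.Bool using (Bool; true; false)
open import Data.Fin using (Fin; toℕ)
open import Data.Vec using (Vec; lookup)
open import Data.List using (List; length)
open import Data.List.Membership.Propositional using (_∈_)
open import Data.List.Relation.Unary.Unique.Propositional using (Unique)
open import Data.Product using (Σ; _×_; _,_)
open import Data.Sum using (_⊎_)
open import Relation.Binary.PropositionalEquality using (_≡_; _≢_)
open import Relation.Nullary using (¬_)

-- The n-dimensional dual cube D_n.
-- Vertices are binary strings of length 2n-1, stored as Vec Bool.
-- Bit positions are 0-based here: paper position p (1 ≤ p ≤ 2n-1)
-- is index p-1.  So paper positions 1..n-1 are indices 0..n-2,
-- positions n..2n-2 are indices n-1..2n-3, and the last bit
-- (position 2n-1) is index 2n-2.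

width : ℕ → ℕ
width n = (n + n) ∸ 1

DVertex : ℕ → Set
DVertex n = Vec Bool (width n)

LastIs : (n : ℕ) → DVertex n → Bool → Set
LastIs n u b = ∀ (i : Fin (width n)) → toℕ i ≡ (n + n) ∸ 2 → lookup u i ≡ b

DAdj : (n : ℕ) → DVertex n → DVertex n → Set
DAdj n u v = Σ (Fin (width n)) λ i →
    lookup u i ≢ lookup v i
  × (∀ j → j ≢ i → lookup u j ≡ lookup v j)
  × ( (toℕ i < n ∸ 1 × LastIs n u false × LastIs n v false)
    ⊎ ((n ∸ 1 ≤ toℕ i × toℕ i < (n + n) ∸ 2) × LastIs n u true × LastIs n v true)
    ⊎ toℕ i ≡ (n + n) ∸ 2 )

SameCluster : (n : ℕ) → DVertex n → DVertex n → Set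
SameCluster n u v =
    (LastIs n u false × LastIs n v false
      × (∀ (i : Fin (width n)) → n ∸ 1 ≤ toℕ i → toℕ i < (n + n) ∸ 2
           → lookup u i ≡ lookup v i))
  ⊎ (LastIs n u true × LastIs n v true
      × (∀ (i : Fin (width n)) → toℕ i < n ∸ 1 → lookup u i ≡ lookup v i))

data Reach {V : Set} (es : List (V × V)) : V → V → Set where
  here  : ∀ {a} → Reach es a a
  fwd   : ∀ {a b c} → (a , b) ∈ es → Reach es b c → Reach es a c
  bwd   : ∀ {a b c} → (b , a) ∈ es → Reach es b c → Reach es a c

record Tree {V : Set} (Adj : V → V → Set) : Set where
  field
    verts      : List V
    edges      : List (V × V)
    vertsUniq  : Unique verts
    edgesUniq  : Unique edges
    edgeAdj    : ∀ {a b} → (a , b) ∈ edges → Adj a b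
    edgeVerts  : ∀ {a b} → (a , b) ∈ edges → a ∈ verts × b ∈ verts
    connected  : ∀ {a b} → a ∈ verts → b ∈ verts → Reach edges a b
    edgeCount  : length edges + 1 ≡ length verts

open Tree public

HasEdge : {V : Set} {Adj : V → V → Set} → Tree Adj → V → V → Set
HasEdge T a b = ((a , b) ∈ edges T) ⊎ ((b , a) ∈ edges T)

InternallyDisjointTrees : {V : Set} (Adj : V → V → Set) (S : List V)
  (m : ℕ) → (Fin m → Tree Adj) → Set
InternallyDisjointTrees Adj S m T =
    (∀ k {s} → s ∈ S → s ∈ verts (T k))
  × (∀ k l → k ≢ l → ∀ {a b} → HasEdge (T k) a b → ¬ HasEdge (T l) a b)
  × (∀ k l → k ≢ l → ∀ {v} → v ∈ verts (T k) → v ∈ verts (T l) → v ∈ S)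

{-# OPTIONS --safe #-}

-- Every cluster is a copy of Q_{n-1}, and any two clusters of different classes are joined by
-- exactly one edge.  The i-th tree uses, on each side, the hub cluster indexed by the i-th
-- neighbour of a centre c.  By a parity argument the centres can be chosen so that no hub
-- contains a point of S.  A fan inside the cluster of each point of S sends n-1 otherwise
-- disjoint paths to the vertices whose cross edges enter the n-1 hubs.  The i-th hubs together
-- with the i-th paths of the four fans form a connected region; these regions meet only in S,
-- and the trees are spanned inside them.
module Submission where

open import Defs
open import Data.Bool using (Bool; true; false; not)
import Data.Bool.Properties as Bool
open import Data.Bool.Properties using (not-involutive; not-¬; ¬-not)
open import Data.Empty using (⊥-elim)
open import Data.Nat using (ℕ; zero; suc; pred; _+_; _∸_; _≤_; _<_; s≤s)
open import Data.Nat.Properties using (+-suc; +-monoʳ-<; m≤m+n)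
open import Data.Fin using (Fin; zero; suc; toℕ; _↑ˡ_; _↑ʳ_; inject₁; fromℕ)
import Data.Fin.Properties as Fin
open import Data.Vec using (Vec; []; _∷_; _++_; _∷ʳ_; lookup; updateAt; splitAt; initLast)
open import Data.Vec.Properties
  using ( ∷-injectiveˡ; ∷-injectiveʳ; ++-injectiveˡ; ++-injectiveʳ; ∷ʳ-injectiveˡ; ∷ʳ-injectiveʳ
        ; lookup∘updateAt; lookup∘updateAt′; updateAt-updateAt; updateAt-id-local
        ; lookup-++ʳ; lookup-++-<; lookup-++-≥ )
import Data.Vec.Properties as Vec
open import Data.List using (List; []; _∷_; map)
open import Data.List.Membership.Propositional using (_∈_; _∉_; find; lose)
open import Data.List.Membership.Propositional.Properties using (∈-map⁺; ∈-map⁻)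
import Data.List.Membership.DecPropositional as DecMembership
open import Data.List.Relation.Unary.All using (All; []; _∷_)
import Data.List.Relation.Unary.All as All
import Data.List.Relation.Unary.All.Properties as All
open import Data.List.Relation.Unary.AllPairs using (AllPairs; []; _∷_)
open import Data.List.Relation.Unary.Any using (here; there)
import Data.List.Relation.Unary.Any as Any
open import Data.Product using (Σ; ∃-syntax; _×_; _,_; proj₁; proj₂)
open import Data.Sum using (_⊎_; inj₁; inj₂)
open import Function using (_∘_)
open import Relation.Binary.Construct.Closure.ReflexiveTransitive
  using (Star; ε; _◅_; _◅◅_; gmap; reverse)
open import Relation.Binary.Definitions using (DecidableEquality; Symmetric)
open import Relation.Binary.PropositionalEquality
  using (_≡_; _≢_; refl; sym; trans; cong; subst)
open import Relation.Nullary using (¬_; yes; no; contradiction)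
open import Relation.Nullary.Decidable using (¬?)

-- Growing trees along walks

module _ {V : Set} where

  reach-weaken : ∀ {es : List (V × V)} {e a b} → Reach es a b → Reach (e ∷ es) a b
  reach-weaken here      = here
  reach-weaken (fwd p r) = fwd (there p) (reach-weaken r)
  reach-weaken (bwd p r) = bwd (there p) (reach-weaken r)

  reach-trans : ∀ {es : List (V × V)} {a b c} → Reach es a b → Reach es b c → Reach es a c
  reach-trans here      s = s
  reach-trans (fwd p r) s = fwd p (reach-trans r s)
  reach-trans (bwd p r) s = bwd p (reach-trans r s)

  mapTree : {A B : V → V → Set} → (∀ {a b} → A a b → B a b) → Tree A → Tree B
  mapTree f T = record
    { verts      = verts T
    ; edges      = edges T
    ; vertsUniq  = vertsUniq T
    ; edgesUniq  = edgesUniq T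
    ; edgeAdj    = f ∘ edgeAdj T
    ; edgeVerts  = edgeVerts T
    ; connected  = connected T
    ; edgeCount  = edgeCount T
    }

module _ {V : Set} {A : V → V → Set} where

  singletonTree : V → Tree A
  singletonTree r = record
    { verts      = r ∷ []
    ; edges      = []
    ; vertsUniq  = [] ∷ []
    ; edgesUniq  = []
    ; edgeAdj    = λ ()
    ; edgeVerts  = λ ()
    ; connected  = λ { (here refl) (here refl) → here }
    ; edgeCount  = refl
    }

  -- The freshness of `b` also makes the new edge fresh, since every edge of `T` has both ends in
  -- `verts T`.
  addLeaf : (T : Tree A) → ∀ {a b} → a ∈ verts T → b ∉ verts T → A a b → Tree A
  addLeaf T {a} {b} a∈T b∉T ab = record
    { verts      = b ∷ verts T
    ; edges      = (a , b) ∷ edges T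
    ; vertsUniq  = All.tabulate (λ v∈T b≡v → b∉T (subst (_∈ verts T) (sym b≡v) v∈T))
                   ∷ vertsUniq T
    ; edgesUniq  = All.tabulate (λ e∈T ab≡e →
                     b∉T (proj₂ (edgeVerts T (subst (_∈ edges T) (sym ab≡e) e∈T))))
                   ∷ edgesUniq T
    ; edgeAdj    = λ { (here refl) → ab ; (there p) → edgeAdj T p }
    ; edgeVerts  = λ { (here refl) → there a∈T , here refl
                     ; (there p)   → there (proj₁ (edgeVerts T p)) , there (proj₂ (edgeVerts T p)) }
    ; connected  = λ { (here refl) (here refl) → here
                     ; (here refl) (there q)   →
                         bwd (here refl) (reach-weaken (connected T a∈T q))
                     ; (there p)   (here refl) →
                         reach-trans (reach-weaken (connected T p a∈T)) (fwd (here refl) here)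
                     ; (there p)   (there q)   → reach-weaken (connected T p q) }
    ; edgeCount  = cong suc (edgeCount T)
    }

module _ {V : Set} (_≟_ : DecidableEquality V) {A : V → V → Set} (P : V → Set)
         (target∈P : ∀ {a b} → A a b → P b) where

  open DecMembership _≟_ using (_∈?_)

  Extension : Tree A → V → Set
  Extension T b =
    Σ (Tree A) λ T′ → (∀ {v} → v ∈ verts T → v ∈ verts T′) × b ∈ verts T′ × All P (verts T′)

  -- The walk may run into the tree again. A step to a vertex already in `T` is followed without
  -- adding its edge, and any other step adds a leaf, so no cycle arises.
  extend : ∀ {a b} (T : Tree A) → All P (verts T) → a ∈ verts T → Star A a b → Extension T b
  extend T P-T a∈T ε = T , (λ v∈T → v∈T) , a∈T , P-T
  extend T P-T a∈T (_◅_ {j = c} ac walk) with c ∈? verts T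
  ... | yes c∈T = extend T P-T c∈T walk
  ... | no  c∉T with extend (addLeaf T a∈T c∉T ac) (target∈P ac ∷ P-T) (here refl) walk
  ...   | T′ , sub , b∈T′ , P-T′ = T′ , sub ∘ there , b∈T′ , P-T′

  spanningTree : ∀ {r} ts → P r → All (Star A r) ts →
    Σ (Tree A) λ T → r ∈ verts T × All (_∈ verts T) ts × All P (verts T)
  spanningTree {r} []       Pr []             = singletonTree r , here refl , [] , Pr ∷ []
  spanningTree     (t ∷ ts) Pr (walk ∷ walks) with spanningTree ts Pr walks
  ... | T , r∈T , ts∈T , P-T with extend T P-T r∈T walk
  ...   | T′ , sub , t∈T′ , P-T′ = T′ , sub r∈T , t∈T′ ∷ All.map sub ts∈T , P-T′

-- Fans in the hypercube

Cube : ℕ → Set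
Cube = Vec Bool

flipAt : ∀ {m} → Cube m → Fin m → Cube m
flipAt p i = updateAt p i not

lookup-flipAt : ∀ {m} (p : Cube m) i → lookup (flipAt p i) i ≡ not (lookup p i)
lookup-flipAt p i = lookup∘updateAt i p

lookup-flipAt-≢ : ∀ {m} (p : Cube m) {i j} → j ≢ i → lookup (flipAt p i) j ≡ lookup p j
lookup-flipAt-≢ p {i} {j} j≢i = lookup∘updateAt′ j i j≢i p

flipAt-involutive : ∀ {m} (p : Cube m) i → flipAt (flipAt p i) i ≡ p
flipAt-involutive p i =
  trans (updateAt-updateAt i p) (updateAt-id-local i p (not-involutive (lookup p i)))

flipAt-≢ : ∀ {m} (p : Cube m) i → flipAt p i ≢ p
flipAt-≢ p i eq =
  not-¬ refl (trans (sym (cong (λ q → lookup q i) eq)) (lookup-flipAt p i))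

flipAt-injective : ∀ {m} (p : Cube m) {i j} → flipAt p i ≡ flipAt p j → i ≡ j
flipAt-injective p {i} {j} eq with i Fin.≟ j
... | yes i≡j = i≡j
... | no  i≢j = contradiction
  (trans (sym (lookup-flipAt-≢ p i≢j)) (trans (sym (cong (λ q → lookup q i) eq)) (lookup-flipAt p i)))
  (not-¬ refl)

infix 4 _~_

data _~_ {m} (p : Cube m) : Cube m → Set where
  flip : ∀ i → p ~ flipAt p i

~-∷ : ∀ {m} b {p q : Cube m} → p ~ q → b ∷ p ~ b ∷ q
~-∷ b (flip i) = flip (suc i)

~-head : ∀ {m} {a b} (p : Cube m) → a ≢ b → a ∷ p ~ b ∷ p
~-head {a = a} {b} p a≢b = subst (λ c → a ∷ p ~ c ∷ p) (sym (¬-not (a≢b ∘ sym))) (flip zero)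

Within : {V : Set} → (V → V → Set) → (V → Set) → V → V → Set
Within A P u v = A u v × P u × P v

-- The walk stays in the smallest subcube that contains p and q.
geodesic : ∀ {m} (p q : Cube m) →
  Star (Within _~_ (λ v → ∀ k → lookup p k ≡ lookup q k → lookup v k ≡ lookup q k)) p q
geodesic []      []      = ε
geodesic (a ∷ p) (b ∷ q) with a Bool.≟ b
... | yes refl = gmap (a ∷_) (λ (s , P , Q) → ~-∷ a s , lift P , lift Q) (geodesic p q)
  where
  lift : ∀ {v} → (∀ k → lookup p k ≡ lookup q k → lookup v k ≡ lookup q k) →
    ∀ k → lookup (a ∷ p) k ≡ lookup (a ∷ q) k → lookup (a ∷ v) k ≡ lookup (a ∷ q) k
  lift P zero    eq = refl
  lift P (suc k) eq = P k eq
... | no a≢b =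
  (~-head p a≢b , (λ k eq → eq) , lift (λ k eq → eq)) ◅
  gmap (b ∷_) (λ (s , P , Q) → ~-∷ b s , lift P , lift Q) (geodesic p q)
  where
  lift : ∀ {v} → (∀ k → lookup p k ≡ lookup q k → lookup v k ≡ lookup q k) →
    ∀ k → lookup (a ∷ p) k ≡ lookup (b ∷ q) k → lookup (b ∷ v) k ≡ lookup (b ∷ q) k
  lift P zero    eq = refl
  lift P (suc k) eq = P k eq

differing : ∀ {m} (p q : Cube m) → p ≢ q → ∃[ j ] lookup p j ≢ lookup q j
differing []      []      p≢q = contradiction refl p≢q
differing (a ∷ p) (b ∷ q) p≢q with a Bool.≟ b
... | no  a≢b  = zero , a≢b
... | yes refl with differing p q (p≢q ∘ cong (a ∷_))
...   | j , neq = suc j , neq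

-- `region i` bounds the `i`-th path by a predicate, so disjointness concerns regions and not vertex
-- lists. `centre∉` strengthens the induction: it keeps `c` free for the one path that is prolonged
-- to it in the next dimension.
record Fan {m} (c s : Cube m) : Set₁ where
  field
    region   : Fin m → Cube m → Set
    source∈  : ∀ i → region i s
    target∈  : ∀ i → region i (flipAt c i)
    path     : ∀ i → Star (Within _~_ (region i)) s (flipAt c i)
    meet     : ∀ {i j v} → i ≢ j → region i v → region j v → v ≡ s
    centre∉  : s ≢ c → ∀ i → ¬ region i c

open Fan

private
  b≢not-b : ∀ {b} → b ≢ not b
  b≢not-b = not-¬ refl

-- Path `zero` crosses at once to the opposite facet and has it to itself; the other paths are those
-- of the smaller fan, inside the facet of `x`.
fan-equal-head : ∀ {m} x {c s : Cube m} → Fan c s → Fan (x ∷ c) (x ∷ s)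
fan-equal-head {m} x {c} {s} F = record
  { region = R ; source∈ = src ; target∈ = tgt ; path = walk ; meet = meet′ ; centre∉ = avoid }
  where
  R : Fin (suc m) → Cube (suc m) → Set
  R zero    v       = (v ≡ x ∷ s) ⊎ (lookup v zero ≡ not x)
  R (suc i) (d ∷ v) = d ≡ x × region F i v

  src : ∀ i → R i (x ∷ s)
  src zero    = inj₁ refl
  src (suc i) = refl , source∈ F i

  tgt : ∀ i → R i (flipAt (x ∷ c) i)
  tgt zero    = inj₂ refl
  tgt (suc i) = refl , target∈ F i

  walk : ∀ i → Star (Within _~_ (R i)) (x ∷ s) (flipAt (x ∷ c) i)
  walk zero    = (flip zero , inj₁ refl , inj₂ refl) ◅
    gmap (not x ∷_) (λ (e , _) → ~-∷ _ e , inj₂ refl , inj₂ refl) (geodesic s c)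
  walk (suc i) = gmap (x ∷_) (λ (e , P , Q) → ~-∷ x e , (refl , P) , (refl , Q)) (path F i)

  meet′ : ∀ {i j v} → i ≢ j → R i v → R j v → v ≡ x ∷ s
  meet′ {zero}  {zero}          i≢j _          _          = contradiction refl i≢j
  meet′ {zero}  {suc j}         i≢j (inj₁ eq)  _          = eq
  meet′ {zero}  {suc j} {_ ∷ _} i≢j (inj₂ eq)  (eq′ , _)  = contradiction (trans (sym eq′) eq) b≢not-b
  meet′ {suc i} {zero}          i≢j _          (inj₁ eq)  = eq
  meet′ {suc i} {zero}  {_ ∷ _} i≢j (eq′ , _)  (inj₂ eq)  = contradiction (trans (sym eq′) eq) b≢not-b
  meet′ {suc i} {suc j} {_ ∷ _} i≢j (refl , P) (_ , Q)    = cong (x ∷_) (meet F (i≢j ∘ cong suc) P Q)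

  avoid : x ∷ s ≢ x ∷ c → ∀ i → ¬ R i (x ∷ c)
  avoid s≢c zero    (inj₁ eq) = s≢c (sym eq)
  avoid s≢c zero    (inj₂ eq) = b≢not-b eq
  avoid s≢c (suc i) (_ , P)   = centre∉ F (s≢c ∘ cong (x ∷_)) i P

-- The source is itself the target for coordinate `zero`, so that path is constant. Every other path
-- takes two steps: it flips its own coordinate, then the head.
fan-neighbour : ∀ {m} x (c : Cube m) → Fan (x ∷ c) (not x ∷ c)
fan-neighbour {m} x c = record
  { region = R ; source∈ = src ; target∈ = tgt ; path = walk ; meet = meet′ ; centre∉ = avoid }
  where
  R : Fin (suc m) → Cube (suc m) → Set
  R zero    v = v ≡ not x ∷ c
  R (suc i) v = (v ≡ not x ∷ c) ⊎ (∃[ d ] v ≡ d ∷ flipAt c i)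

  src : ∀ i → R i (not x ∷ c)
  src zero    = refl
  src (suc i) = inj₁ refl

  tgt : ∀ i → R i (flipAt (x ∷ c) i)
  tgt zero    = refl
  tgt (suc i) = inj₂ (x , refl)

  walk : ∀ i → Star (Within _~_ (R i)) (not x ∷ c) (flipAt (x ∷ c) i)
  walk zero    = ε
  walk (suc i) = (flip (suc i) , inj₁ refl , inj₂ (not x , refl)) ◅
    (~-head _ (b≢not-b ∘ sym) , inj₂ (not x , refl) , inj₂ (x , refl)) ◅ ε

  meet′ : ∀ {i j v} → i ≢ j → R i v → R j v → v ≡ not x ∷ c
  meet′ {zero}          i≢j P         Q         = P
  meet′ {suc i} {zero}  i≢j P         Q         = Q
  meet′ {suc i} {suc j} i≢j (inj₁ P)  Q         = P
  meet′ {suc i} {suc j} i≢j (inj₂ P)  (inj₁ Q)  = Q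
  meet′ {suc i} {suc j} i≢j (inj₂ (_ , P)) (inj₂ (_ , Q)) =
    contradiction (cong suc (flipAt-injective c (∷-injectiveʳ (trans (sym P) Q)))) i≢j

  avoid : not x ∷ c ≢ x ∷ c → ∀ i → ¬ R i (x ∷ c)
  avoid s≢c zero    P              = s≢c (sym P)
  avoid s≢c (suc i) (inj₁ P)       = s≢c (sym P)
  avoid s≢c (suc i) (inj₂ (_ , P)) = flipAt-≢ c i (sym (∷-injectiveʳ P))

-- The path of the smaller fan that ends at flipAt c j, where s and c differ, is prolonged to
-- not x ∷ c.  Its former role is taken over by a path through the facet of vertices x ∷ v with
-- v and s equal in coordinate j, a facet that contains neither x ∷ c nor any other target.
fan-distinct-head : ∀ {m} x {c s : Cube m} → s ≢ c → Fan c s → Fan (x ∷ c) (not x ∷ s)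
fan-distinct-head {m} x {c} {s} s≢c F = record
  { region = R ; source∈ = src ; target∈ = tgt ; path = walk ; meet = meet′ ; centre∉ = avoid }
  where
  j : Fin m
  j = proj₁ (differing s c s≢c)

  sⱼ≢cⱼ : lookup s j ≢ lookup c j
  sⱼ≢cⱼ = proj₂ (differing s c s≢c)

  sⱼ≡flip : lookup s j ≡ lookup (flipAt c j) j
  sⱼ≡flip = trans (¬-not sⱼ≢cⱼ) (sym (lookup-flipAt c j))

  Detour Direct : Fin m → Cube (suc m) → Set
  Detour i (d ∷ v) = i ≡ j × d ≡ x × lookup v j ≡ lookup s j
  Direct i (d ∷ v) = i ≢ j × ((d ≡ not x × region F i v) ⊎ (d ≡ x × v ≡ flipAt c i))

  R : Fin (suc m) → Cube (suc m) → Set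
  R zero    (d ∷ v) = d ≡ not x × (region F j v ⊎ v ≡ c)
  R (suc i) v       = (v ≡ not x ∷ s) ⊎ (Detour i v ⊎ Direct i v)

  src : ∀ i → R i (not x ∷ s)
  src zero    = refl , inj₁ (source∈ F j)
  src (suc i) = inj₁ refl

  tgt : ∀ i → R i (flipAt (x ∷ c) i)
  tgt zero    = refl , inj₂ refl
  tgt (suc i) with i Fin.≟ j
  ... | yes i≡j = inj₂ (inj₁ (i≡j , refl ,
          subst (λ k → lookup (flipAt c k) j ≡ lookup s j) (sym i≡j) (sym sⱼ≡flip)))
  ... | no  i≢j = inj₂ (inj₂ (i≢j , inj₂ (refl , refl)))

  walk : ∀ i → Star (Within _~_ (R i)) (not x ∷ s) (flipAt (x ∷ c) i)
  walk zero =
    gmap (not x ∷_) (λ (e , P , Q) → ~-∷ _ e , (refl , inj₁ P) , (refl , inj₁ Q)) (path F j) ◅◅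
    (subst (not x ∷ flipAt c j ~_) (cong (not x ∷_) (flipAt-involutive c j)) (flip (suc j))
      , (refl , inj₁ (target∈ F j)) , (refl , inj₂ refl)) ◅ ε
  walk (suc i) with i Fin.≟ j
  ... | yes refl =
    (~-head s (b≢not-b ∘ sym) , inj₁ refl , inj₂ (inj₁ (refl , refl , refl))) ◅
    gmap (x ∷_) (λ (e , P , Q) → ~-∷ x e , lift P , lift Q) (geodesic s (flipAt c j))
    where
    lift : ∀ {v} →
      (∀ k → lookup s k ≡ lookup (flipAt c j) k → lookup v k ≡ lookup (flipAt c j) k) →
      R (suc j) (x ∷ v)
    lift P = inj₂ (inj₁ (refl , refl , trans (P j sⱼ≡flip) (sym sⱼ≡flip)))
  -- The path of the smaller fan is followed in the facet of `not x`; only its last step enters the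
  -- facet of `x`, directly at the target.
  ... | no i≢j =
    gmap (not x ∷_) (λ (e , P , Q) → ~-∷ _ e , lift P , lift Q) (path F i) ◅◅
    (~-head _ (b≢not-b ∘ sym) , lift (target∈ F i) , inj₂ (inj₂ (i≢j , inj₂ (refl , refl)))) ◅ ε
    where
    lift : ∀ {v} → region F i v → R (suc i) (not x ∷ v)
    lift P = inj₂ (inj₂ (i≢j , inj₁ (refl , P)))

  zero-suc : ∀ {i v} → R zero v → R (suc i) v → v ≡ not x ∷ s
  zero-suc {v = _ ∷ _} P              (inj₁ eq)                                    = eq
  zero-suc {v = _ ∷ _} (dP , _)       (inj₂ (inj₁ (_ , dQ , _)))                   =
    contradiction (trans (sym dQ) dP) b≢not-b
  zero-suc {v = _ ∷ _} (refl , inj₁ P) (inj₂ (inj₂ (i≢j , inj₁ (_ , Q))))          =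
    cong (not x ∷_) (meet F i≢j Q P)
  -- The prolongation ends at `not x ∷ c`, which the regions of `F` miss by `centre∉`.
  zero-suc {i} {_ ∷ _} (_ , inj₂ refl) (inj₂ (inj₂ (_ , inj₁ (_ , Q))))            =
    contradiction Q (centre∉ F s≢c i)
  zero-suc {v = _ ∷ _} (dP , _)       (inj₂ (inj₂ (_ , inj₂ (dQ , _))))            =
    contradiction (trans (sym dQ) dP) b≢not-b

  detour-direct : ∀ {i v} → lookup v zero ≡ x → ∀ {k} → Detour k v → ¬ Direct i v
  detour-direct {v = _ ∷ _} refl (_ , _ , _)  (_ , inj₁ (d , _)) = b≢not-b d
  -- Coordinate `j` decides: the detour agrees with `s` there, while `flipAt c i` with `i ≢ j` still
  -- agrees with `c`.
  detour-direct {v = _ ∷ _} refl (_ , _ , eq) (i≢j , inj₂ (_ , refl)) =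
    sⱼ≢cⱼ (trans (sym eq) (lookup-flipAt-≢ c (i≢j ∘ sym)))

  head-detour : ∀ {i v} → Detour i v → lookup v zero ≡ x
  head-detour {v = _ ∷ _} (_ , d , _) = d

  direct-direct : ∀ {i k v} → i ≢ k → Direct i v → Direct k v → v ≡ not x ∷ s
  direct-direct {v = _ ∷ _} i≢k (_ , inj₁ (refl , P)) (_ , inj₁ (_ , Q)) =
    cong (not x ∷_) (meet F i≢k P Q)
  direct-direct {v = _ ∷ _} i≢k (_ , inj₁ (dP , _)) (_ , inj₂ (dQ , _)) =
    contradiction (trans (sym dQ) dP) b≢not-b
  direct-direct {v = _ ∷ _} i≢k (_ , inj₂ (dP , _)) (_ , inj₁ (dQ , _)) =
    contradiction (trans (sym dP) dQ) b≢not-b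
  direct-direct {v = _ ∷ _} i≢k (_ , inj₂ (_ , P)) (_ , inj₂ (_ , Q)) =
    contradiction (flipAt-injective c (trans (sym P) Q)) i≢k

  suc-suc : ∀ {i k} v → i ≢ k → R (suc i) v → R (suc k) v → v ≡ not x ∷ s
  suc-suc v       i≢k (inj₁ P)        _               = P
  suc-suc v       i≢k (inj₂ _)        (inj₁ Q)        = Q
  suc-suc (_ ∷ _) i≢k (inj₂ (inj₁ (refl , _))) (inj₂ (inj₁ (refl , _))) = contradiction refl i≢k
  suc-suc v       i≢k (inj₂ (inj₁ P)) (inj₂ (inj₂ Q)) =
    ⊥-elim (detour-direct {v = v} (head-detour {v = v} P) P Q)
  suc-suc v       i≢k (inj₂ (inj₂ P)) (inj₂ (inj₁ Q)) =
    ⊥-elim (detour-direct {v = v} (head-detour {v = v} Q) Q P)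
  suc-suc v       i≢k (inj₂ (inj₂ P)) (inj₂ (inj₂ Q)) = direct-direct {v = v} i≢k P Q

  meet′ : ∀ {i k v} → i ≢ k → R i v → R k v → v ≡ not x ∷ s
  meet′ {zero}  {zero}      i≢k _ _ = contradiction refl i≢k
  meet′ {zero}  {suc k} {v} i≢k P Q = zero-suc {k} {v} P Q
  meet′ {suc i} {zero}  {v} i≢k P Q = zero-suc {i} {v} Q P
  meet′ {suc i} {suc k} {v} i≢k P Q = suc-suc v (i≢k ∘ cong suc) P Q

  avoid : not x ∷ s ≢ x ∷ c → ∀ i → ¬ R i (x ∷ c)
  avoid _   zero    (d , _)                                 = b≢not-b d
  avoid neq (suc i) (inj₁ P)                                = neq (sym P)
  avoid _   (suc i) (inj₂ (inj₁ (_ , _ , eq)))              = sⱼ≢cⱼ (sym eq)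
  avoid _   (suc i) (inj₂ (inj₂ (_ , inj₁ (d , _))))        = b≢not-b d
  avoid _   (suc i) (inj₂ (inj₂ (_ , inj₂ (_ , eq))))       = flipAt-≢ c i (sym eq)

-- Induction on the dimension. If the heads differ, equal tails need a case of their own, because
-- the detour relies on a coordinate where the tails differ.
fan : ∀ {m} (c s : Cube m) → Fan c s
fan [] [] = record
  { region = λ () ; source∈ = λ () ; target∈ = λ () ; path = λ () ; meet = λ {} ; centre∉ = λ _ () }
fan (x ∷ c) (y ∷ s) with y Bool.≟ x
... | yes refl = fan-equal-head x (fan c s)
... | no  y≢x with ¬-not y≢x | Vec.≡-dec Bool._≟_ s c
...   | refl | yes refl = fan-neighbour x c
...   | refl | no  s≢c  = fan-distinct-head x s≢c (fan c s)

-- Choosing the hubs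

parity : ∀ {m} → Cube m → Bool
parity []          = false
parity (false ∷ p) = parity p
parity (true  ∷ p) = not (parity p)

parity-flipAt : ∀ {m} (p : Cube m) i → parity (flipAt p i) ≡ not (parity p)
parity-flipAt (false ∷ p) zero    = refl
parity-flipAt (true  ∷ p) zero    = sym (not-involutive (parity p))
parity-flipAt (false ∷ p) (suc i) = parity-flipAt p i
parity-flipAt (true  ∷ p) (suc i) = cong not (parity-flipAt p i)

-- The hypercube is bipartite, with `parity` as the colouring.
flipAt-≢-parity : ∀ {m} (p q : Cube m) → parity p ≡ parity q → ∀ i → flipAt p i ≢ q
flipAt-≢-parity p q eq i refl = b≢not-b (trans eq (parity-flipAt p i))

-- Only the neighbours of `c` have to avoid `fs`; `c` itself may occur in it.
Clear : ∀ {m} → List (Cube m) → Set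
Clear {m} fs = Σ (Cube m) λ c → ∀ {f} → f ∈ fs → ∀ i → flipAt c i ≢ f

-- A vertex of the parity of f and g is adjacent to neither, so only h can be a problem;
-- if its parity is different, then a vertex at distance 3 from h will do.
clear-same-parity : ∀ {k} (f g h : Cube (3 + k)) → parity f ≡ parity g → Clear (f ∷ g ∷ h ∷ [])
clear-same-parity f g h f≡g with parity f Bool.≟ parity h
... | yes f≡h = f , λ where
  (here refl)                 → flipAt-≢-parity f f refl
  (there (here refl))         → flipAt-≢-parity f g f≡g
  (there (there (here refl))) → flipAt-≢-parity f h f≡h
clear-same-parity f g h@(a ∷ b ∷ d ∷ r) f≡g | no f≢h = c , λ where
    (here refl)                 → flipAt-≢-parity c f c≡f
    (there (here refl))         → flipAt-≢-parity c g (trans c≡f f≡g)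
    (there (there (here refl))) → far
  where
  c = flipAt (flipAt (flipAt h zero) (suc zero)) (suc (suc zero))

  c≡f : parity c ≡ parity f
  c≡f =
    trans (parity-flipAt (flipAt (flipAt h zero) (suc zero)) (suc (suc zero))) (
    trans (cong not (parity-flipAt (flipAt h zero) (suc zero))) (
    trans (not-involutive _) (
    trans (parity-flipAt h zero) (
    sym (¬-not f≢h)))))

  -- A flip at `zero` leaves the difference in the next coordinate, and any other flip leaves the
  -- one at `zero`.
  far : ∀ i → flipAt c i ≢ h
  far zero    eq = b≢not-b (sym (∷-injectiveˡ (∷-injectiveʳ eq)))
  far (suc i) eq = b≢not-b (sym (∷-injectiveˡ eq))

-- By pigeonhole, two of the three parities agree.
clear-three : ∀ {k} (f g h : Cube (3 + k)) → Clear (f ∷ g ∷ h ∷ [])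
clear-three f g h with parity f Bool.≟ parity g
... | yes f≡g = clear-same-parity f g h f≡g
... | no  f≢g with parity f Bool.≟ parity h
...   | yes f≡h with clear-same-parity f h g f≡h
...     | c , clear = c , λ where
  (here eq)                 → clear (here eq)
  (there (here eq))         → clear (there (there (here eq)))
  (there (there (here eq))) → clear (there (here eq))
clear-three f g h | no f≢g | no f≢h
  with clear-same-parity g h f
         (trans (sym (not-involutive _)) (trans (cong not (sym (¬-not f≢g))) (sym (¬-not (f≢h ∘ sym)))))
... | c , clear = c , λ where
  (here eq)                 → clear (there (there (here eq)))
  (there (here eq))         → clear (here eq)
  (there (there (here eq))) → clear (there (here eq))

-- The dual cube

-- A vertex of class false (the paper's 0) has its position in the first n-1 bits and its cluster
-- in the next n-1 bits; for class true the roles are exchanged.  This makes both classes alike.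
record Vertex (m : ℕ) : Set where
  constructor vertex
  field
    side    : Bool
    cluster : Cube m
    pos     : Cube m

open Vertex

vertex-≡ : ∀ {m} {u v : Vertex m} →
  side u ≡ side v → cluster u ≡ cluster v → pos u ≡ pos v → u ≡ v
vertex-≡ refl refl refl = refl

SameCell : ∀ {m} → Vertex m → Vertex m → Set
SameCell u v = side u ≡ side v × cluster u ≡ cluster v

-- A cross edge changes only the last bit. Since the two blocks of bits exchange roles with the
-- class, cluster and position trade places.
data Step {m} : Vertex m → Vertex m → Set where
  intra : ∀ {κ a p q} → p ~ q → Step (vertex κ a p) (vertex κ a q)
  cross : ∀ {κ κ′ a p} → κ ≢ κ′ → Step (vertex κ a p) (vertex κ′ p a)

~-sym : ∀ {m} → Symmetric (_~_ {m})
~-sym {x = p} (flip i) = subst (flipAt p i ~_) (flipAt-involutive p i) (flip i)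

~-irrefl : ∀ {m} {p : Cube m} → ¬ (p ~ p)
~-irrefl {m} {p} e = go e refl
  where
  go : ∀ {q} → p ~ q → q ≢ p
  go (flip i) = flipAt-≢ p i

step-sym : ∀ {m} → Symmetric (Step {m})
step-sym (intra e)    = intra (~-sym e)
step-sym (cross κ≢κ′) = cross (κ≢κ′ ∘ sym)

-- Hubs, spokes and the regions they form

module Regions {m} (S : List (Vertex m))
  (separated : ∀ {s t} → s ∈ S → t ∈ S → SameCell s t → s ≡ t)
  (centre : Bool → Cube m)
  (centre-clear : ∀ {s t} → s ∈ S → t ∈ S → side t ≢ side s →
    ∀ i → flipAt (centre (side s)) i ≢ cluster s)
  where

  -- The terminal `t` of the other class confines hubs to a class that some terminal enters by a
  -- cross edge, and it provides the premise of `centre-clear`.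
  Hub : Fin m → Vertex m → Set
  Hub i v = cluster v ≡ flipAt (centre (side v)) i × ∃[ t ] t ∈ S × side t ≢ side v

  -- A cross edge turns the position into the cluster index of the other class, so the targets must
  -- be the neighbours of the centre of that class.
  fanAt : (t : Vertex m) → Fan (centre (not (side t))) (pos t)
  fanAt t = fan (centre (not (side t))) (pos t)

  Spoke : Fin m → Vertex m → Set
  Spoke i v = ∃[ t ] t ∈ S × SameCell t v × region (fanAt t) i (pos v)

  Region : Fin m → Vertex m → Set
  Region i v = Hub i v ⊎ Spoke i v

  -- Excluding edges inside S makes edge-disjointness a consequence of vertex-disjointness.
  Link : Fin m → Vertex m → Vertex m → Set
  Link i u v = Step u v × ¬ (u ∈ S × v ∈ S) × Region i u × Region i v

  link-sym : ∀ {i} → Symmetric (Link i)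
  link-sym (e , ¬S , P , Q) = step-sym e , (λ (v∈S , u∈S) → ¬S (u∈S , v∈S)) , Q , P

  hub-foreign : ∀ {i v t} → Hub i v → t ∈ S → ¬ SameCell t v
  hub-foreign (eq , _ , t′∈S , t′≢v) t∈S (refl , refl) =
    centre-clear t∈S t′∈S t′≢v _ (sym eq)

  hub∉S : ∀ {i v} → Hub i v → v ∉ S
  hub∉S {v = v} H v∈S = hub-foreign {v = v} H v∈S (refl , refl)

  terminal∈ : ∀ {t} → t ∈ S → ∀ i → Region i t
  terminal∈ {t} t∈S i = inj₂ (t , t∈S , (refl , refl) , source∈ (fanAt t) i)

  hub-link : ∀ {i u v} → Step u v → Hub i u → Hub i v → Link i u v
  hub-link e H K = e , (λ (u∈S , _) → hub∉S H u∈S) , inj₁ H , inj₁ K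

  hub-intra : ∀ {i κ a p} q → Hub i (vertex κ a p) → Star (Link i) (vertex κ a p) (vertex κ a q)
  hub-intra {κ = κ} {a} {p} q H =
    gmap (vertex κ a) (λ (e , _) → hub-link (intra e) H H) (geodesic p q)

  hub-walk : ∀ {i u v} → Hub i u → Hub i v → Star (Link i) u v
  hub-walk {i} {vertex κ a p} {vertex κ′ b q} H K with κ Bool.≟ κ′
  -- The single edge between the two hubs leaves the first at position `b`, the cluster index of the
  -- second.
  ... | no κ≢κ′ = hub-intra b H ◅◅ hub-link (cross κ≢κ′) H K ◅ hub-intra q K
  ... | yes refl with trans (proj₁ H) (sym (proj₁ K))
  ...   | refl = hub-intra q H

  -- The far end of the cross edge at the `i`-th target of the fan of `t`.
  entry : Fin m → Vertex m → Vertex m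
  entry i t = vertex (not (side t)) (flipAt (centre (not (side t))) i) (cluster t)

  entry-hub : ∀ i {t} → t ∈ S → Hub i (entry i t)
  entry-hub i {t} t∈S = refl , t , t∈S , b≢not-b

  spoke-walk : ∀ i {t} → t ∈ S → Star (Link i) t (entry i t)
  spoke-walk i {t} t∈S =
    gmap (vertex (side t) (cluster t)) lift (path (fanAt t) i) ◅◅
    (cross b≢not-b , (λ (_ , e∈S) → hub∉S (entry-hub i t∈S) e∈S) ,
      spoke (target∈ (fanAt t) i) , inj₁ (entry-hub i t∈S)) ◅ ε
    where
    at : Cube m → Vertex m
    at = vertex (side t) (cluster t)

    spoke : ∀ {p} → region (fanAt t) i p → Region i (at p)
    spoke P = inj₂ (t , t∈S , (refl , refl) , P)

    lift : ∀ {p q} → Within _~_ (region (fanAt t) i) p q → Link i (at p) (at q)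
    lift {p} {q} (e , P , Q) = intra e , ¬both , spoke P , spoke Q
      where
      ¬both : ¬ (at p ∈ S × at q ∈ S)
      -- Both ends lie in one cluster, which holds at most one terminal, so the edge would be a
      -- loop.
      ¬both (p∈S , q∈S) with separated p∈S q∈S (refl , refl)
      ... | refl = ~-irrefl e

  terminal-walk : ∀ i {s t} → s ∈ S → t ∈ S → Star (Link i) s t
  terminal-walk i s∈S t∈S =
    spoke-walk i s∈S ◅◅ hub-walk (entry-hub i s∈S) (entry-hub i t∈S) ◅◅
    reverse link-sym (spoke-walk i t∈S)

  -- Hubs of one class with different indices are distinct clusters, and no hub is the cluster of a
  -- terminal. Two spokes through `v` belong to the same terminal, where `meet` of its fan applies.
  regions-meet : ∀ {i j v} → i ≢ j → Region i v → Region j v → v ∈ S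
  regions-meet i≢j (inj₁ (P , _)) (inj₁ (Q , _)) =
    contradiction (flipAt-injective _ (trans (sym P) Q)) i≢j
  regions-meet {v = v} i≢j (inj₁ H) (inj₂ (_ , t∈S , same , _)) =
    contradiction same (hub-foreign {v = v} H t∈S)
  regions-meet {v = v} i≢j (inj₂ (_ , t∈S , same , _)) (inj₁ H) =
    contradiction same (hub-foreign {v = v} H t∈S)
  regions-meet i≢j (inj₂ (s , s∈S , (κ , a) , P)) (inj₂ (t , t∈S , (κ′ , a′) , Q))
    with separated s∈S t∈S (trans κ (sym κ′) , trans a (sym a′))
  ... | refl = subst (_∈ S) (vertex-≡ κ a (sym (meet (fanAt s) i≢j P Q))) s∈S

-- Encoding by bit strings

encode : ∀ {m} → Vertex m → DVertex (suc m)
encode (vertex false a p) = p ++ (a ∷ʳ false)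
encode (vertex true  a p) = a ++ (p ∷ʳ true)

-- `width (suc m)` reduces to `m + suc m`: a block of `m` bits, then a second block followed by the
-- class bit.
decode : ∀ {m} (v : DVertex (suc m)) → ∃[ u ] v ≡ encode {m} u
decode {m} v with splitAt m v
... | p , r , refl with initLast r
...   | a , false , refl = vertex false a p , refl
...   | a , true  , refl = vertex true  p a , refl

encode-injective : ∀ {m} (u v : Vertex m) → encode u ≡ encode v → u ≡ v
encode-injective (vertex false a p) (vertex false b q) eq = vertex-≡ refl
  (∷ʳ-injectiveˡ a b (++-injectiveʳ p q eq)) (++-injectiveˡ p q eq)
encode-injective (vertex false a p) (vertex true b q) eq =
  contradiction (∷ʳ-injectiveʳ a q (++-injectiveʳ p b eq)) λ ()
encode-injective (vertex true a p) (vertex false b q) eq =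
  contradiction (∷ʳ-injectiveʳ p b (++-injectiveʳ a q eq)) λ ()
encode-injective (vertex true a p) (vertex true b q) eq = vertex-≡ refl
  (++-injectiveˡ a b eq) (∷ʳ-injectiveˡ p q (++-injectiveʳ a b eq))

module _ {A : Set} {f : A → A} where

  updateAt-++ˡ : ∀ {m n} (xs : Vec A m) (ys : Vec A n) i →
    updateAt (xs ++ ys) (i ↑ˡ n) f ≡ updateAt xs i f ++ ys
  updateAt-++ˡ (x ∷ xs) ys zero    = refl
  updateAt-++ˡ (x ∷ xs) ys (suc i) = cong (x ∷_) (updateAt-++ˡ xs ys i)

  updateAt-++ʳ : ∀ {m n} (xs : Vec A m) (ys : Vec A n) i →
    updateAt (xs ++ ys) (m ↑ʳ i) f ≡ xs ++ updateAt ys i f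
  updateAt-++ʳ []       ys i = refl
  updateAt-++ʳ (x ∷ xs) ys i = cong (x ∷_) (updateAt-++ʳ xs ys i)

  updateAt-∷ʳ-inject₁ : ∀ {n} (xs : Vec A n) y i →
    updateAt (xs ∷ʳ y) (inject₁ i) f ≡ updateAt xs i f ∷ʳ y
  updateAt-∷ʳ-inject₁ (x ∷ xs) y zero    = refl
  updateAt-∷ʳ-inject₁ (x ∷ xs) y (suc i) = cong (x ∷_) (updateAt-∷ʳ-inject₁ xs y i)

  updateAt-∷ʳ-fromℕ : ∀ {n} (xs : Vec A n) y →
    updateAt (xs ∷ʳ y) (fromℕ n) f ≡ xs ∷ʳ f y
  updateAt-∷ʳ-fromℕ []       y = refl
  updateAt-∷ʳ-fromℕ (x ∷ xs) y = cong (x ∷_) (updateAt-∷ʳ-fromℕ xs y)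

lookup-∷ʳ-fromℕ : ∀ {A : Set} {n} (xs : Vec A n) y → lookup (xs ∷ʳ y) (fromℕ n) ≡ y
lookup-∷ʳ-fromℕ []       y = refl
lookup-∷ʳ-fromℕ (x ∷ xs) y = lookup-∷ʳ-fromℕ xs y

module _ (m : ℕ) where

  lastIndex : (suc m + suc m) ∸ 2 ≡ m + m
  lastIndex = cong pred (+-suc m m)

  toℕ-last : toℕ (m ↑ʳ fromℕ m) ≡ (suc m + suc m) ∸ 2
  toℕ-last = trans (Fin.toℕ-↑ʳ m (fromℕ m)) (trans (cong (m +_) (Fin.toℕ-fromℕ m)) (sym lastIndex))

  last-++-∷ʳ : ∀ (p q : Cube m) b → LastIs (suc m) (p ++ (q ∷ʳ b)) b
  last-++-∷ʳ p q b i eq with Fin.toℕ-injective {i = i} {j = m ↑ʳ fromℕ m} (trans eq (sym toℕ-last))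
  ... | refl = trans (lookup-++ʳ p (q ∷ʳ b) (fromℕ m)) (lookup-∷ʳ-fromℕ q b)

  lastIs-side : (u : Vertex m) → LastIs (suc m) (encode u) (side u)
  lastIs-side (vertex false a p) = last-++-∷ʳ p a false
  lastIs-side (vertex true  a p) = last-++-∷ʳ a p true

  -- The three alternatives of `DAdj (suc m)`, as a condition on the number of the flipped bit.
  EdgeIndex : ℕ → Vertex m → Vertex m → Set
  EdgeIndex k u v =
      (k < m × LastIs (suc m) (encode u) false × LastIs (suc m) (encode v) false)
    ⊎ ((m ≤ k × k < (suc m + suc m) ∸ 2)
        × LastIs (suc m) (encode u) true × LastIs (suc m) (encode v) true)
    ⊎ k ≡ (suc m + suc m) ∸ 2

  adjacent : ∀ {u v : Vertex m} i → updateAt (encode u) i not ≡ encode v →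
    EdgeIndex (toℕ i) u v → DAdj (suc m) (encode u) (encode v)
  adjacent {u} {v} i eq index = i
    , (λ same → b≢not-b (trans same
        (trans (cong (λ w → lookup w i) (sym eq)) (lookup-flipAt (encode u) i))))
    , (λ j j≢i → trans (sym (lookup-flipAt-≢ (encode u) j≢i)) (cong (λ w → lookup w j) eq))
    , index

  -- An edge inside a cluster flips a bit of the first block for class `false` and of the second for
  -- class `true`. A cross edge flips only the last bit, because `encode` undoes the exchange of
  -- cluster and position.
  encode-step : ∀ {u v : Vertex m} → Step u v → DAdj (suc m) (encode u) (encode v)
  encode-step {u@(vertex false a p)} {v} (intra (flip i)) =
    adjacent {u} {v} (i ↑ˡ suc m) (updateAt-++ˡ p (a ∷ʳ false) i)
      (inj₁ (subst (_< m) (sym (Fin.toℕ-↑ˡ i (suc m))) (Fin.toℕ<n i) , lastIs-side u , lastIs-side v))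
  encode-step {u@(vertex true a p)} {v} (intra (flip i)) =
    adjacent {u} {v} (m ↑ʳ inject₁ i)
      (trans (updateAt-++ʳ a (p ∷ʳ true) (inject₁ i)) (cong (a ++_) (updateAt-∷ʳ-inject₁ p true i)))
      (inj₂ (inj₁ ((subst (m ≤_) (sym index) (m≤m+n m (toℕ i))
                  , subst (_< (suc m + suc m) ∸ 2) (sym index)
                      (subst (m + toℕ i <_) (sym lastIndex) (+-monoʳ-< m (Fin.toℕ<n i))))
                  , lastIs-side u , lastIs-side v)))
    where
    index : toℕ (m ↑ʳ inject₁ i) ≡ m + toℕ i
    index = trans (Fin.toℕ-↑ʳ m (inject₁ i)) (cong (m +_) (Fin.toℕ-inject₁ i))
  encode-step {vertex false a p} {vertex false _ _} (cross κ≢κ′) = contradiction refl κ≢κ′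
  encode-step {vertex true  a p} {vertex true  _ _} (cross κ≢κ′) = contradiction refl κ≢κ′
  encode-step {u@(vertex false a p)} {v@(vertex true _ _)} (cross _) =
    adjacent {u} {v} (m ↑ʳ fromℕ m)
      (trans (updateAt-++ʳ p (a ∷ʳ false) (fromℕ m)) (cong (p ++_) (updateAt-∷ʳ-fromℕ a false)))
      (inj₂ (inj₂ toℕ-last))
  encode-step {u@(vertex true a p)} {v@(vertex false _ _)} (cross _) =
    adjacent {u} {v} (m ↑ʳ fromℕ m)
      (trans (updateAt-++ʳ a (p ∷ʳ true) (fromℕ m)) (cong (a ++_) (updateAt-∷ʳ-fromℕ p true)))
      (inj₂ (inj₂ toℕ-last))

  sameCell⇒sameCluster : ∀ {u v : Vertex m} → SameCell u v → SameCluster (suc m) (encode u) (encode v)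
  sameCell⇒sameCluster {u@(vertex false a p)} {v@(vertex false a q)} (refl , refl) =
    inj₁ (lastIs-side u , lastIs-side v , λ i m≤i _ →
      trans (lookup-++-≥ p (a ∷ʳ false) i m≤i) (sym (lookup-++-≥ q (a ∷ʳ false) i m≤i)))
  sameCell⇒sameCluster {u@(vertex true a p)} {v@(vertex true a q)} (refl , refl) =
    inj₂ (lastIs-side u , lastIs-side v , λ i i<m →
      trans (lookup-++-< a (p ∷ʳ true) i i<m) (sym (lookup-++-< a (q ∷ʳ true) i i<m)))

-- Spanning trees inside the regions

module _ {m} (S : List (Vertex m))
  (separated : ∀ {s t} → s ∈ S → t ∈ S → SameCell s t → s ≡ t)
  (centre : Bool → Cube m)
  (centre-clear : ∀ {s t} → s ∈ S → t ∈ S → side t ≢ side s →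
    ∀ i → flipAt (centre (side s)) i ≢ cluster s)
  {root : Vertex m} (root∈S : root ∈ S)
  where

  open Regions S separated centre centre-clear

  private
    -- Serves as the adjacency while the trees grow, so that each edge remembers that it is a link;
    -- `mapTree` weakens it to `DAdj` at the end.
    data EncodedLink (i : Fin m) : DVertex (suc m) → DVertex (suc m) → Set where
      encodedLink : ∀ {u v} → Link i u v → EncodedLink i (encode u) (encode v)

    data EncodedRegion (i : Fin m) : DVertex (suc m) → Set where
      encodedRegion : ∀ {u} → Region i u → EncodedRegion i (encode u)

    spanned : ∀ i → Σ (Tree (EncodedLink i)) λ T → encode root ∈ verts T
      × All (_∈ verts T) (map encode S) × All (EncodedRegion i) (verts T)
    spanned i = spanningTree (Vec.≡-dec Bool._≟_) (EncodedRegion i)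
      (λ { (encodedLink (_ , _ , _ , Q)) → encodedRegion Q })
      (map encode S) (encodedRegion (terminal∈ root∈S i))
      (All.map⁺ (All.tabulate λ t∈S → gmap encode encodedLink (terminal-walk i root∈S t∈S)))

    linkTree : ∀ i → Tree (EncodedLink i)
    linkTree i = proj₁ (spanned i)

    encoded-meet : ∀ {i j v} → i ≢ j → EncodedRegion i v → EncodedRegion j v → v ∈ map encode S
    -- Two images under `encode` cannot be unified by matching, so the index of `Q` is generalised
    -- and the equation left to `encode-injective`.
    encoded-meet {j = j} i≢j (encodedRegion {u} P) Q = go Q refl
      where
      go : ∀ {v} → EncodedRegion j v → v ≡ encode u → encode u ∈ map encode S
      go (encodedRegion {w} Q) eq with encode-injective w u eq
      ... | refl = ∈-map⁺ encode (regions-meet i≢j P Q)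

    verts-meet : ∀ i j → i ≢ j → ∀ {v} → v ∈ verts (linkTree i) → v ∈ verts (linkTree j) →
      v ∈ map encode S
    verts-meet i j i≢j p q = encoded-meet i≢j
      (All.lookup (proj₂ (proj₂ (proj₂ (spanned i)))) p)
      (All.lookup (proj₂ (proj₂ (proj₂ (spanned j)))) q)

    encode∈⁻ : ∀ {u} → encode u ∈ map encode S → u ∈ S
    encode∈⁻ {u} u∈ with ∈-map⁻ encode u∈
    ... | t , t∈S , eq = subst (_∈ S) (sym (encode-injective u t eq)) t∈S

    link∉S : ∀ {i a b} → EncodedLink i a b → a ∈ map encode S → b ∉ map encode S
    link∉S (encodedLink (_ , ¬S , _)) a∈ b∈ = ¬S (encode∈⁻ a∈ , encode∈⁻ b∈)

    edge∉S : ∀ i {a b} → HasEdge (linkTree i) a b → a ∈ map encode S → b ∉ map encode S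
    edge∉S i (inj₁ e) a∈ b∈ = link∉S (edgeAdj (linkTree i) e) a∈ b∈
    edge∉S i (inj₂ e) a∈ b∈ = link∉S (edgeAdj (linkTree i) e) b∈ a∈

    edge-verts : ∀ i {a b} → HasEdge (linkTree i) a b →
      a ∈ verts (linkTree i) × b ∈ verts (linkTree i)
    edge-verts i (inj₁ e) = edgeVerts (linkTree i) e
    edge-verts i (inj₂ e) with edgeVerts (linkTree i) e
    ... | b∈ , a∈ = a∈ , b∈

  disjointTrees :
    Σ (Fin m → Tree (DAdj (suc m))) (InternallyDisjointTrees (DAdj (suc m)) (map encode S) m)
  disjointTrees =
      (λ i → mapTree (λ { (encodedLink (e , _)) → encode-step m e }) (linkTree i))
    , (λ i t∈ → All.lookup (proj₁ (proj₂ (proj₂ (spanned i)))) t∈)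
    -- Both ends of a common edge lie in two regions, hence in `S`, and no link joins two vertices
    -- of `S`.
    , (λ i j i≢j e f →
        let a∈i , b∈i = edge-verts i e
            a∈j , b∈j = edge-verts j f
        in edge∉S i e (verts-meet i j i≢j a∈i a∈j) (verts-meet i j i≢j b∈i b∈j))
    , verts-meet

-- Centres for four terminals, and the theorem

remove : ∀ {A : Set} {x y z w t : A} → t ∈ x ∷ y ∷ z ∷ w ∷ [] →
  ∃[ a ] ∃[ b ] ∃[ c ] (∀ {s} → s ∈ x ∷ y ∷ z ∷ w ∷ [] → s ≡ t ⊎ s ∈ a ∷ b ∷ c ∷ [])
remove (here refl) = _ , _ , _ , λ where
  (here eq) → inj₁ eq
  (there p) → inj₂ p
remove (there (here refl)) = _ , _ , _ , λ where
  (here eq)         → inj₂ (here eq)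
  (there (here eq)) → inj₁ eq
  (there (there p)) → inj₂ (there p)
remove (there (there (here refl))) = _ , _ , _ , λ where
  (here eq)                 → inj₂ (here eq)
  (there (here eq))         → inj₂ (there (here eq))
  (there (there (here eq))) → inj₁ eq
  (there (there (there p))) → inj₂ (there (there p))
remove (there (there (there (here refl)))) = _ , _ , _ , λ where
  (here eq)                         → inj₂ (here eq)
  (there (here eq))                 → inj₂ (there (here eq))
  (there (there (here eq)))         → inj₂ (there (there (here eq)))
  (there (there (there (here eq)))) → inj₁ eq

-- Hubs of class κ are needed only if some terminal has the other class, and then at most three
-- clusters of class κ have to be avoided.
centres : ∀ {k} (x y z w : Vertex (3 + k)) (let S = x ∷ y ∷ z ∷ w ∷ []) κ →
  Σ (Cube (3 + k)) λ c → ∀ {s t} → s ∈ S → t ∈ S → side s ≡ κ → side t ≢ κ →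
    ∀ i → flipAt c i ≢ cluster s
centres x y z w κ with Any.any? (λ t → ¬? (side t Bool.≟ κ)) (x ∷ y ∷ z ∷ w ∷ [])
-- All terminals have class `κ`, so the condition is vacuous and `cluster x` is an arbitrary
-- default.
... | no  none = cluster x , λ _ t∈S _ t≢κ → contradiction (lose t∈S t≢κ) none
... | yes some with find some
...   | t₀ , t₀∈S , t₀≢κ with remove t₀∈S
...     | a , b , c , rest with clear-three (cluster a) (cluster b) (cluster c)
...       | d , clear = d , λ s∈S _ s≡κ _ → avoids (rest s∈S) s≡κ
  where
  avoids : ∀ {s} → s ≡ t₀ ⊎ s ∈ a ∷ b ∷ c ∷ [] → side s ≡ κ → ∀ i → flipAt d i ≢ cluster s
  avoids (inj₁ refl) s≡κ = contradiction s≡κ t₀≢κ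
  avoids (inj₂ s∈)   _   = clear (∈-map⁺ cluster s∈)

allPairs-lookup : ∀ {A : Set} {R : A → A → Set} → Symmetric R → ∀ {xs x y} →
  AllPairs R xs → x ∈ xs → y ∈ xs → x ≡ y ⊎ R x y
allPairs-lookup R-sym (_  ∷ _)   (here refl) (here refl) = inj₁ refl
allPairs-lookup R-sym (Rx ∷ _)   (here refl) (there q)   = inj₂ (All.lookup Rx q)
allPairs-lookup R-sym (Rx ∷ _)   (there p)   (here refl) = inj₂ (R-sym (All.lookup Rx p))
allPairs-lookup R-sym (_  ∷ Rxs) (there p)   (there q)   = allPairs-lookup R-sym Rxs p q

theorem10 : (n : ℕ) → 4 ≤ n → (x y z w : DVertex n)
    → x ≢ y → x ≢ z → x ≢ w → y ≢ z → y ≢ w → z ≢ w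
    → ¬ SameCluster n x y → ¬ SameCluster n x z → ¬ SameCluster n x w
    → ¬ SameCluster n y z → ¬ SameCluster n y w → ¬ SameCluster n z w
    → Σ (Fin (n ∸ 1) → Tree (DAdj n)) λ T →
    InternallyDisjointTrees (DAdj n) (x ∷ y ∷ z ∷ w ∷ []) (n ∸ 1) T
-- The bound `4 ≤ n` gives `m` the form `3 + k`, which leaves room for the vertex at distance 3 used
-- in the choice of centres.
theorem10 (suc m@(suc (suc (suc _)))) (s≤s (s≤s (s≤s (s≤s _)))) x y z w _ _ _ _ _ _
          x≁y x≁z x≁w y≁z y≁w z≁w
  with decode {m} x | decode {m} y | decode {m} z | decode {m} w
... | x′ , refl | y′ , refl | z′ , refl | w′ , refl =
  disjointTrees S separated (λ κ → proj₁ (centres x′ y′ z′ w′ κ))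
    (λ s∈S t∈S t≢s → proj₂ (centres x′ y′ z′ w′ _) s∈S t∈S refl t≢s) (here refl)
  where
  S : List (Vertex m)
  S = x′ ∷ y′ ∷ z′ ∷ w′ ∷ []

  cells : AllPairs (λ s t → ¬ SameCell s t) S
  cells =
      (x≁y ∘ sameCell⇒sameCluster m {x′} {y′} ∷ x≁z ∘ sameCell⇒sameCluster m {x′} {z′}
        ∷ x≁w ∘ sameCell⇒sameCluster m {x′} {w′} ∷ [])
    ∷ (y≁z ∘ sameCell⇒sameCluster m {y′} {z′} ∷ y≁w ∘ sameCell⇒sameCluster m {y′} {w′} ∷ [])
    ∷ (z≁w ∘ sameCell⇒sameCluster m {z′} {w′} ∷ [])
    ∷ [] ∷ []

  separated : ∀ {s t} → s ∈ S → t ∈ S → SameCell s t → s ≡ t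
  separated s∈S t∈S same
    with allPairs-lookup (λ ¬same (κ , a) → ¬same (sym κ , sym a)) cells s∈S t∈S
  ... | inj₁ s≡t   = s≡t
  ... | inj₂ ¬same = contradiction same ¬same
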